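{- Let $r$ be a positive integer, let $H$ be an $r$-degenerate bipartite graph on $h$ vertices, and let $n>h^{10}$. Then $\mathrm{ex}(n,H)<n^{2-\frac{1}{8r}}$.
   Context: A graph is $r$-degenerate if every one of its subgraphs contains a vertex of degree at most $r$. The Turán number $\mathrm{ex}(n,H)$ is the maximum number of edges in a graph on $n$ vertices that does not contain $H$ as a subgraph. -}

module Defs where

open import Data.Nat using (ℕ; zero; suc; _+_; _<_; _≤_)
open import Data.Bool using (Bool; true; false; if_then_else_; _∧_)
open import Data.Fin using (Fin; toℕ)
open import Data.List using (List; map; allFin)
open import Data.Nat.ListAction using (sum)
open import Data.Nat using (_<ᵇ_)
open import Data.Product using (Σ; ∃; _×_; _,_)
open import Relation.Binary.PropositionalEquality using (_≡_; _≢_)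
open import Function.Definitions using (Injective)

record Graph (n : ℕ) : Set where
  field
    adj   : Fin n → Fin n → Bool
    sym   : ∀ u v → adj u v ≡ adj v u
    irrefl : ∀ v → adj v v ≡ false
open Graph public

count : {n : ℕ} → (Fin n → Bool) → ℕ
count {n} p = sum (map (λ i → if p i then 1 else 0) (allFin n))

edges : {n : ℕ} → Graph n → ℕ
edges {n} G = sum (map (λ u → count (λ v → (toℕ u <ᵇ toℕ v) ∧ adj G u v)) (allFin n))

_⊆G_ : {h n : ℕ} → Graph h → Graph n → Set
_⊆G_ {h} {n} H G =
  Σ (Fin h → Fin n) λ f → Injective _≡_ _≡_ f ×
    (∀ u v → adj H u v ≡ true → adj G (f u) (f v) ≡ true)

Bipartite : {h : ℕ} → Graph h → Set
Bipartite {h} H = Σ (Fin h → Bool) λ c → ∀ u v → adj H u v ≡ true → c u ≢ c v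

degIn : {h : ℕ} → Graph h → (Fin h → Bool) → Fin h → ℕ
degIn H S v = count (λ u → S u ∧ adj H v u)

Degenerate : ℕ → {h : ℕ} → Graph h → Set
Degenerate r {h} H =
  (S : Fin h → Bool) → (∃ λ v → S v ≡ true) →
    ∃ λ v → (S v ≡ true) × (degIn H S v ≤ r)

{-# OPTIONS --safe #-}

module Submission where

-- Alon–Krivelevich–Sudakov: count the pairs (T, T′) of 2r-tuples of vertices of G that are
-- completely joined.  Convexity gives at least about n^(7r/2) of them, while the pairs for which
-- some r-tuple S in N(T) has fewer than h common neighbours in N(T′), that is, for which S ++ T′
-- has fewer than h common neighbours, number at most n^(3r) (h-1)^(2r), and symmetrically.
-- For n > h^10 some pair is bad in neither way; H is then embedded greedily between N(T) and
-- N(T′) along a degeneracy order, each vertex being adjacent to at most r earlier ones.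

open import Defs
import Data.Bool as Bool
open import Data.Bool using (Bool; true; false; _∧_; not; if_then_else_)
open import Data.Bool.ListAction using (all)
open import Data.Bool.Properties using (∧-assoc; ∧-comm; ∧-zeroʳ; ∧-identityʳ; T-≡; ¬-not; not-¬)
open import Data.Empty using (⊥-elim)
open import Data.Fin using (Fin; zero; suc; toℕ)
import Data.Fin as Fin
open import Data.Fin.Properties using (any?)
open import Data.List using (List; []; _∷_; _++_; map; filter; allFin; length; replicate; cartesianProductWith)
open import Data.List.Properties using (map-cong; map-tabulate; length-map; length-++; length-replicate; length-tabulate)
open import Data.List.Membership.Propositional using (_∈_)
open import Data.List.Membership.Propositional.Properties using (∈-cartesianProductWith⁺; ∈-cartesianProductWith⁻; ∈-allFin; ∈-map⁺; ∈-map⁻; ∈-filter⁺; ∈-filter⁻; ∈-++⁺ˡ)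
open import Data.List.Relation.Unary.Any using (here; there)
open import Data.Nat using (ℕ; zero; suc; _+_; _<_; _≤_; _^_; _*_; _∸_; _<ᵇ_; z≤n; s≤s; NonZero)
open import Data.Nat.ListAction using (sum)
open import Data.Nat.Properties
open import Data.Nat.Tactic.RingSolver using (solve-∀)
open import Data.Product using (∃; ∃₂; _×_; _,_; proj₁; proj₂)
open import Data.Sum using ([_,_]′)
open import Function using (_∘_; id; const)
open import Function.Bundles using (Equivalence)
open import Relation.Binary.PropositionalEquality as ≡ using (_≡_; _≢_; _≗_; refl; cong; cong₂; subst)
open import Relation.Nullary using (¬_; yes; no; does; contradiction)

private
  variable
    A B C : Set

-- Finite sums and 0-1 indicators.

∑ : List A → (A → ℕ) → ℕ
∑ xs f = sum (map f xs)

χ : Bool → ℕ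
χ b = if b then 1 else 0

χ-≤1 : ∀ b → χ b ≤ 1
χ-≤1 false = z≤n
χ-≤1 true  = s≤s z≤n

χ-∧ : ∀ a b → χ (a ∧ b) ≡ χ a * χ b
χ-∧ false b = refl
χ-∧ true  b = ≡.sym (+-identityʳ (χ b))

χ-∧-≤ : ∀ a b → χ (a ∧ b) ≤ χ b
χ-∧-≤ false b = z≤n
χ-∧-≤ true  b = ≤-refl

χ≡0⇒false : ∀ b → χ b ≡ 0 → b ≡ false
χ≡0⇒false false _ = refl

χ>0⇒true : ∀ b → 0 < χ b → b ≡ true
χ>0⇒true true _ = refl

∧-true⁻ : ∀ a b → a ∧ b ≡ true → a ≡ true × b ≡ true
∧-true⁻ true true _ = refl , refl

∧-true⁺ : ∀ {a b} → a ≡ true → b ≡ true → a ∧ b ≡ true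
∧-true⁺ refl refl = refl

∑-cong : {f g : A → ℕ} → f ≗ g → ∀ xs → ∑ xs f ≡ ∑ xs g
∑-cong eq xs = cong sum (map-cong eq xs)

∑-mono-≤ : {f g : A → ℕ} → (∀ x → f x ≤ g x) → ∀ xs → ∑ xs f ≤ ∑ xs g
∑-mono-≤ le []       = z≤n
∑-mono-≤ le (x ∷ xs) = +-mono-≤ (le x) (∑-mono-≤ le xs)

∑-mono-< : {f g : A → ℕ} → (∀ x → f x ≤ g x) → ∀ {x xs} → x ∈ xs → f x < g x → ∑ xs f < ∑ xs g
∑-mono-< le {xs = _ ∷ ys} (here refl) lt = +-mono-<-≤ lt (∑-mono-≤ le ys)
∑-mono-< le {xs = y ∷ _}  (there x∈)  lt = +-mono-≤-< (le y) (∑-mono-< le x∈ lt)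

∑-distrib-+ : ∀ (f g : A → ℕ) xs → ∑ xs (λ x → f x + g x) ≡ ∑ xs f + ∑ xs g
∑-distrib-+ f g []       = refl
∑-distrib-+ f g (x ∷ xs) = begin
  f x + g x + ∑ xs (λ x → f x + g x)   ≡⟨ cong (f x + g x +_) (∑-distrib-+ f g xs) ⟩
  f x + g x + (∑ xs f + ∑ xs g)        ≡⟨ interchange (f x) (g x) (∑ xs f) (∑ xs g) ⟩
  f x + ∑ xs f + (g x + ∑ xs g)        ∎
  where
  open ≡.≡-Reasoning
  interchange : ∀ a b c d → a + b + (c + d) ≡ a + c + (b + d)
  interchange = solve-∀

*-distribˡ-∑ : ∀ c (f : A → ℕ) xs → ∑ xs (λ x → c * f x) ≡ c * ∑ xs f
*-distribˡ-∑ c f []       = ≡.sym (*-zeroʳ c)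
*-distribˡ-∑ c f (x ∷ xs) =
  ≡.trans (cong (c * f x +_) (*-distribˡ-∑ c f xs)) (≡.sym (*-distribˡ-+ c (f x) (∑ xs f)))

*-distribʳ-∑ : ∀ c (f : A → ℕ) xs → ∑ xs (λ x → f x * c) ≡ ∑ xs f * c
*-distribʳ-∑ c f xs = begin
  ∑ xs (λ x → f x * c)  ≡⟨ ∑-cong (λ x → *-comm (f x) c) xs ⟩
  ∑ xs (λ x → c * f x)  ≡⟨ *-distribˡ-∑ c f xs ⟩
  c * ∑ xs f            ≡⟨ *-comm c (∑ xs f) ⟩
  ∑ xs f * c            ∎
  where open ≡.≡-Reasoning

∑-const : ∀ c (xs : List A) → ∑ xs (const c) ≡ length xs * c
∑-const c []       = refl
∑-const c (x ∷ xs) = cong (c +_) (∑-const c xs)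

∑-zero : ∀ (xs : List A) → ∑ xs (const 0) ≡ 0
∑-zero xs = ≡.trans (∑-const 0 xs) (*-zeroʳ (length xs))

∑-swap : ∀ (f : A → B → ℕ) xs ys →
  ∑ xs (λ x → ∑ ys (λ y → f x y)) ≡ ∑ ys (λ y → ∑ xs (λ x → f x y))
∑-swap f []       ys = ≡.sym (∑-zero ys)
∑-swap f (x ∷ xs) ys =
  ≡.trans (cong (∑ ys (f x) +_) (∑-swap f xs ys)) (≡.sym (∑-distrib-+ (f x) _ ys))

∑-++ : ∀ (f : A → ℕ) xs ys → ∑ (xs ++ ys) f ≡ ∑ xs f + ∑ ys f
∑-++ f []       ys = refl
∑-++ f (x ∷ xs) ys = ≡.trans (cong (f x +_) (∑-++ f xs ys)) (≡.sym (+-assoc (f x) _ _))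

∑-map : ∀ (f : B → ℕ) (g : A → B) xs → ∑ (map g xs) f ≡ ∑ xs (f ∘ g)
∑-map f g []       = refl
∑-map f g (x ∷ xs) = cong (f (g x) +_) (∑-map f g xs)

∑-cartesianProductWith : ∀ (f : C → ℕ) (g : A → B → C) xs ys →
  ∑ (cartesianProductWith g xs ys) f ≡ ∑ xs (λ x → ∑ ys (λ y → f (g x y)))
∑-cartesianProductWith f g []       ys = refl
∑-cartesianProductWith f g (x ∷ xs) ys =
  ≡.trans (∑-++ f (map (g x) ys) _)
          (cong₂ _+_ (∑-map f (g x) ys) (∑-cartesianProductWith f g xs ys))

∑-bound : ∀ {f : A → ℕ} {c} → (∀ x → f x ≤ c) → ∀ xs → ∑ xs f ≤ length xs * c
∑-bound {c = c} le xs = ≤-trans (∑-mono-≤ le xs) (≤-reflexive (∑-const c xs))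

-- The averaging step: it selects `T`, then `T′`, and later a fresh vertex, each time by comparison
-- with a count.
∑-<⇒∃ : ∀ (f g : A → ℕ) xs → ∑ xs f < ∑ xs g → ∃ λ x → x ∈ xs × f x < g x
∑-<⇒∃ f g (x ∷ xs) lt with f x <? g x
... | yes fx<gx = x , here refl , fx<gx
... | no  fx≮gx with ∑-<⇒∃ f g xs (+-cancelˡ-< (f x) _ _ (<-≤-trans lt (+-monoˡ-≤ (∑ xs g) (≮⇒≥ fx≮gx))))
...   | y , y∈ , fy<gy = y , there y∈ , fy<gy

∈⇒≤∑ : ∀ (f : A → ℕ) {x xs} → x ∈ xs → f x ≤ ∑ xs f
∈⇒≤∑ f (here refl) = m≤m+n _ _
∈⇒≤∑ f (there x∈)  = ≤-trans (∈⇒≤∑ f x∈) (m≤n+m _ _)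

∑-allFin-suc : ∀ {n} (f : Fin (suc n) → ℕ) → ∑ (allFin (suc n)) f ≡ f zero + ∑ (allFin n) (f ∘ suc)
∑-allFin-suc {n} f = cong (f zero +_) (cong sum
  (≡.trans (map-tabulate suc f) (≡.sym (map-tabulate id (f ∘ suc)))))

∑-χ-≟ : ∀ {n} (x : Fin n) → ∑ (allFin n) (λ y → χ (does (x Fin.≟ y))) ≤ 1
∑-χ-≟ {suc n} zero    = ≤-reflexive (≡.trans (∑-allFin-suc {n} (λ y → χ (does (zero Fin.≟ y))))
  (cong suc (∑-zero (allFin n))))
∑-χ-≟ {suc n} (suc x) = ≤-trans (≤-reflexive (∑-allFin-suc {n} (λ y → χ (does (suc x Fin.≟ y))))) (∑-χ-≟ x)

-- The power mean inequality over the natural numbers.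

rearrangement : ∀ k a b → a * b ^ k + b * a ^ k ≤ a * a ^ k + b * b ^ k
rearrangement k a b = [ ordered a b , swapped ]′ (≤-total a b)
  where
  ordered : ∀ a b → a ≤ b → a * b ^ k + b * a ^ k ≤ a * a ^ k + b * b ^ k
  -- With `b = a + d` and `b ^ k = a ^ k + e`, the right side exceeds the left by exactly `d * e`,
  -- which is (b - a)(b^k - a^k) written without subtraction.
  ordered a b a≤b with m≤n⇒∃[o]m+o≡n a≤b | m≤n⇒∃[o]m+o≡n (^-monoˡ-≤ k a≤b)
  ... | d , refl | e , eq rewrite ≡.sym eq =
    ≤-trans (m≤m+n _ (d * e)) (≤-reflexive (lemma a d (a ^ k) e))
    where
    lemma : ∀ a d p e → a * (p + e) + (a + d) * p + d * e ≡ a * p + (a + d) * (p + e)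
    lemma = solve-∀
  swapped : b ≤ a → a * b ^ k + b * a ^ k ≤ a * a ^ k + b * b ^ k
  swapped b≤a = ≤-trans (≤-reflexive (+-comm (a * b ^ k) _))
    (≤-trans (ordered b a b≤a) (≤-reflexive (+-comm (b * b ^ k) _)))

^-distribʳ-* : ∀ k a b → (a * b) ^ k ≡ a ^ k * b ^ k
^-distribʳ-* zero    a b = refl
^-distribʳ-* (suc k) a b = ≡.trans (cong (a * b *_) (^-distribʳ-* k a b)) (interchange a b (a ^ k) (b ^ k))
  where
  interchange : ∀ a b c d → a * b * (c * d) ≡ a * c * (b * d)
  interchange = solve-∀

∑*∑ : ∀ (f g : A → ℕ) xs → ∑ xs (λ x → ∑ xs (λ y → f x * g y)) ≡ ∑ xs f * ∑ xs g
∑*∑ f g xs = ≡.trans (∑-cong (λ x → *-distribˡ-∑ (f x) g xs) xs) (*-distribʳ-∑ (∑ xs g) f xs)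

-- Chebyshev's sum inequality: `f` and its power are similarly ordered, so `rearrangement` applies
-- to every pair of entries. Summing over ordered pairs produces each side twice, hence the factor 2
-- that is cancelled.
chebyshev : ∀ k (f : A → ℕ) xs → ∑ xs f * ∑ xs (λ x → f x ^ k) ≤ length xs * ∑ xs (λ x → f x ^ suc k)
chebyshev k f xs = *-cancelˡ-≤ 2 (begin
  2 * (F * G)                   ≡⟨ double (F * G) ⟩
  F * G + F * G
    ≡⟨ cong₂ _+_ (∑*∑ f (λ x → f x ^ k) xs)
        (≡.trans (∑-swap (λ x y → f y * f x ^ k) xs xs) (∑*∑ f (λ x → f x ^ k) xs)) ⟨
  ∑ xs (λ x → ∑ xs (λ y → f x * f y ^ k)) + ∑ xs (λ x → ∑ xs (λ y → f y * f x ^ k))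
    ≡⟨ ∑∑-distrib-+ (λ x y → f x * f y ^ k) (λ x y → f y * f x ^ k) ⟨
  ∑ xs (λ x → ∑ xs (λ y → f x * f y ^ k + f y * f x ^ k))
    ≤⟨ ∑-mono-≤ (λ x → ∑-mono-≤ (λ y → rearrangement k (f x) (f y)) xs) xs ⟩
  ∑ xs (λ x → ∑ xs (λ y → f x ^ suc k + f y ^ suc k))
    ≡⟨ ∑∑-distrib-+ (λ x y → f x ^ suc k) (λ x y → f y ^ suc k) ⟩
  ∑ xs (λ x → ∑ xs (λ y → f x ^ suc k)) + ∑ xs (λ x → ∑ xs (λ y → f y ^ suc k))
    ≡⟨ cong₂ _+_
        (≡.trans (∑-swap (λ x y → f x ^ suc k) xs xs) (∑-const H xs))
        (∑-const H xs) ⟩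
  length xs * H + length xs * H ≡⟨ double (length xs * H) ⟨
  2 * (length xs * H)           ∎)
  where
  open ≤-Reasoning
  F = ∑ xs f
  G = ∑ xs (λ x → f x ^ k)
  H = ∑ xs (λ x → f x ^ suc k)
  double : ∀ a → 2 * a ≡ a + a
  double = solve-∀
  ∑∑-distrib-+ : ∀ (p q : _ → _ → ℕ) → ∑ xs (λ x → ∑ xs (λ y → p x y + q x y))
    ≡ ∑ xs (λ x → ∑ xs (λ y → p x y)) + ∑ xs (λ x → ∑ xs (λ y → q x y))
  ∑∑-distrib-+ p q = ≡.trans (∑-cong (λ x → ∑-distrib-+ (p x) (q x) xs) xs)
    (∑-distrib-+ (λ x → ∑ xs (p x)) (λ x → ∑ xs (q x)) xs)

-- Jensen's inequality for powers with denominators cleared. Each induction step trades one factor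
-- `∑ xs f` for one factor `length xs` by `chebyshev`.
power-mean : ∀ k (f : A → ℕ) xs → ∑ xs f ^ k * length xs ≤ length xs ^ k * ∑ xs (λ x → f x ^ k)
power-mean zero    f xs = ≤-reflexive (cong (λ m → m + 0) (≡.sym
  (≡.trans (∑-const 1 xs) (*-identityʳ (length xs)))))
power-mean (suc k) f xs = begin
  F * F ^ k * m                              ≡⟨ *-assoc F (F ^ k) m ⟩
  F * (F ^ k * m)                            ≤⟨ *-monoʳ-≤ F (power-mean k f xs) ⟩
  F * (m ^ k * ∑ xs (λ x → f x ^ k))         ≡⟨ swap F (m ^ k) _ ⟩
  m ^ k * (F * ∑ xs (λ x → f x ^ k))         ≤⟨ *-monoʳ-≤ (m ^ k) (chebyshev k f xs) ⟩
  m ^ k * (m * ∑ xs (λ x → f x ^ suc k))     ≡⟨ regroup (m ^ k) m _ ⟩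
  m * m ^ k * ∑ xs (λ x → f x ^ suc k)       ∎
  where
  open ≤-Reasoning
  F = ∑ xs f
  m = length xs
  swap : ∀ a b c → a * (b * c) ≡ b * (a * c)
  swap = solve-∀
  regroup : ∀ a b c → a * (b * c) ≡ b * a * c
  regroup = solve-∀

-- Universal tests on lists, and ordered tuples of vertices.

all-∧ : ∀ (p q : A → Bool) xs → all (λ x → p x ∧ q x) xs ≡ all p xs ∧ all q xs
all-∧ p q []       = refl
all-∧ p q (x ∷ xs) = ≡.trans (cong ((p x ∧ q x) ∧_) (all-∧ p q xs)) (interchange (p x) (q x) _ _)
  where
  interchange : ∀ a b c d → (a ∧ b) ∧ (c ∧ d) ≡ (a ∧ c) ∧ (b ∧ d)
  interchange false b     c     d = refl
  interchange true  false false d = refl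
  interchange true  false true  d = refl
  interchange true  true  c     d = refl

all-true : ∀ (xs : List A) → all (const true) xs ≡ true
all-true []       = refl
all-true (x ∷ xs) = all-true xs

all-cong : {p q : A → Bool} → p ≗ q → ∀ xs → all p xs ≡ all q xs
all-cong eq []       = refl
all-cong eq (x ∷ xs) = cong₂ _∧_ (eq x) (all-cong eq xs)

all-++ : ∀ (p : A → Bool) xs ys → all p (xs ++ ys) ≡ all p xs ∧ all p ys
all-++ p []       ys = refl
all-++ p (x ∷ xs) ys = ≡.trans (cong (p x ∧_) (all-++ p xs ys)) (≡.sym (∧-assoc (p x) _ _))

all⇒∈ : ∀ {p : A → Bool} {xs x} → all p xs ≡ true → x ∈ xs → p x ≡ true
all⇒∈ {p = p} {y ∷ ys} eq (here refl) = proj₁ (∧-true⁻ (p y) _ eq)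
all⇒∈ {p = p} {y ∷ ys} eq (there x∈)  = all⇒∈ (proj₂ (∧-true⁻ (p y) _ eq)) x∈

∈⇒all : ∀ (p : A → Bool) xs → (∀ {x} → x ∈ xs → p x ≡ true) → all p xs ≡ true
∈⇒all p []       h = refl
∈⇒all p (x ∷ xs) h = ∧-true⁺ (h (here refl)) (∈⇒all p xs (h ∘ there))

-- Entries may repeat: counts are then exact powers, and a tuple can be padded with copies of one
-- vertex.
tuples : ∀ n → ℕ → List (List (Fin n))
tuples n zero    = [] ∷ []
tuples n (suc k) = cartesianProductWith _∷_ (allFin n) (tuples n k)

∈-tuples⁺ : ∀ {n} (xs : List (Fin n)) → xs ∈ tuples n (length xs)
∈-tuples⁺ []       = here refl
∈-tuples⁺ (x ∷ xs) = ∈-cartesianProductWith⁺ _∷_ (∈-allFin x) (∈-tuples⁺ xs)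

∈-tuples⁻ : ∀ {n} k {xs : List (Fin n)} → xs ∈ tuples n k → length xs ≡ k
∈-tuples⁻ zero    (here refl) = refl
∈-tuples⁻ {n} (suc k) xs∈ with ∈-cartesianProductWith⁻ _∷_ (allFin n) (tuples n k) xs∈
... | _ , _ , _ , ys∈ , refl = cong suc (∈-tuples⁻ k ys∈)

-- The entries are chosen independently, so the indicator factors. This turns counts of tuples into
-- the power sums that `power-mean` bounds.
∑-tuples-all : ∀ {n} k (p : Fin n → Bool) →
  ∑ (tuples n k) (χ ∘ all p) ≡ ∑ (allFin n) (χ ∘ p) ^ k
∑-tuples-all zero    p = refl
∑-tuples-all {n} (suc k) p = begin
  ∑ (tuples n (suc k)) (χ ∘ all p)
    ≡⟨ ∑-cartesianProductWith (χ ∘ all p) _∷_ (allFin n) (tuples n k) ⟩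
  ∑ (allFin n) (λ x → ∑ (tuples n k) (λ xs → χ (p x ∧ all p xs)))
    ≡⟨ ∑-cong (λ x → ∑-cong (λ xs → χ-∧ (p x) (all p xs)) (tuples n k)) (allFin n) ⟩
  ∑ (allFin n) (λ x → ∑ (tuples n k) (λ xs → χ (p x) * χ (all p xs)))
    ≡⟨ ∑-cong (λ x → *-distribˡ-∑ (χ (p x)) (χ ∘ all p) (tuples n k)) (allFin n) ⟩
  ∑ (allFin n) (λ x → χ (p x) * ∑ (tuples n k) (χ ∘ all p))
    ≡⟨ *-distribʳ-∑ (∑ (tuples n k) (χ ∘ all p)) (χ ∘ p) (allFin n) ⟩
  ∑ (allFin n) (χ ∘ p) * ∑ (tuples n k) (χ ∘ all p)
    ≡⟨ cong (∑ (allFin n) (χ ∘ p) *_) (∑-tuples-all k p) ⟩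
  ∑ (allFin n) (χ ∘ p) ^ suc k ∎
  where open ≡.≡-Reasoning

length-allFin : ∀ n → length (allFin n) ≡ n
length-allFin n = length-tabulate id

length-as-∑ : ∀ (xs : List A) → ∑ xs (const 1) ≡ length xs
length-as-∑ xs = ≡.trans (∑-const 1 xs) (*-identityʳ (length xs))

length-tuples : ∀ n k → length (tuples n k) ≡ n ^ k
length-tuples n k = begin
  length (tuples n k)                       ≡⟨ length-as-∑ (tuples n k) ⟨
  ∑ (tuples n k) (const 1)                  ≡⟨ ∑-cong (cong χ ∘ all-true) (tuples n k) ⟨
  ∑ (tuples n k) (χ ∘ all (const true))     ≡⟨ ∑-tuples-all k (const true) ⟩
  ∑ (allFin n) (const 1) ^ k                ≡⟨ cong (_^ k) (length-as-∑ (allFin n)) ⟩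
  length (allFin n) ^ k                     ≡⟨ cong (_^ k) (length-allFin n) ⟩
  n ^ k                                     ∎
  where open ≡.≡-Reasoning

-- Common neighbourhoods and the number of bicliques.

module _ {n : ℕ} (G : Graph n) where

  private
    V : List (Fin n)
    V = allFin n

  common : List (Fin n) → Fin n → Bool
  common S w = all (λ s → adj G s w) S

  complete : List (Fin n) → List (Fin n) → Bool
  complete S T = all (common S) T

  codegree : List (Fin n) → ℕ
  codegree S = ∑ V (χ ∘ common S)

  degreeSum : ℕ
  degreeSum = ∑ V (λ w → ∑ V (λ v → χ (adj G v w)))

  -- Dropping the test on the order of `u` and `v` gives up a factor of 2 and leaves a plain sum of
  -- degrees, to which `power-mean` applies.
  edges≤degreeSum : edges G ≤ degreeSum
  edges≤degreeSum = ∑-mono-≤ (λ u → ∑-mono-≤ (λ v →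
    ≤-trans (χ-∧-≤ (toℕ u <ᵇ toℕ v) (adj G u v))
            (≤-reflexive (cong χ (Graph.sym G u v)))) V) V

  -- Peeling `s` off `S` splits the test over `T` in two; by symmetry of adjacency the part for `s`
  -- is `common T s`.
  complete-comm : ∀ S T → complete S T ≡ complete T S
  complete-comm []      T = all-true T
  complete-comm (s ∷ S) T = begin
    all (λ t → adj G s t ∧ common S t) T           ≡⟨ all-∧ (adj G s) (common S) T ⟩
    all (adj G s) T ∧ complete S T                 ≡⟨ cong₂ _∧_ (all-cong (Graph.sym G s) T) (complete-comm S T) ⟩
    common T s ∧ complete T S                      ∎
    where open ≡.≡-Reasoning

  complete-++ : ∀ S S′ T → complete (S ++ S′) T ≡ complete S T ∧ complete S′ T
  complete-++ S S′ T = ≡.trans (all-cong (λ t → all-++ (λ s → adj G s t) S S′) T)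
    (all-∧ (common S) (common S′) T)

  -- Double counting of pairs of a tuple and a vertex `w` joined to all its entries: first by the
  -- tuple, then by the centre `w`.
  ∑-codegree : ∀ t → ∑ (tuples n t) codegree ≡ ∑ V (λ w → ∑ V (λ v → χ (adj G v w)) ^ t)
  ∑-codegree t = ≡.trans (∑-swap (λ T w → χ (common T w)) (tuples n t) V)
    (∑-cong (λ w → ∑-tuples-all t (λ v → adj G v w)) V)

  -- The number of homomorphisms from K_{t,t} to `G`, since entries may coincide.
  bicliques : ℕ → ℕ
  bicliques t = ∑ (tuples n t) (λ S → ∑ (tuples n t) (λ T → χ (complete S T)))

  -- Two applications of the power mean inequality (Sidorenko's inequality for K_{t,t}).
  bicliques-lower-bound : ∀ t →
    degreeSum ^ (t * t) * n ^ t * n ^ t ≤ n ^ (t * t) * n ^ (t * t) * bicliques t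
  bicliques-lower-bound t = begin
    degreeSum ^ (t * t) * N * N             ≡⟨ cong (λ m → m * N * N) (^-*-assoc degreeSum t t) ⟨
    (degreeSum ^ t) ^ t * N * N             ≡⟨ cong (_* N) (^-distribʳ-* t (degreeSum ^ t) n) ⟨
    (degreeSum ^ t * n) ^ t * N             ≤⟨ *-monoˡ-≤ N (^-monoˡ-≤ t first) ⟩
    (N * P) ^ t * N                         ≡⟨ cong (_* N) (^-distribʳ-* t N P) ⟩
    N ^ t * P ^ t * N                       ≡⟨ *-assoc (N ^ t) _ _ ⟩
    N ^ t * (P ^ t * N)                     ≤⟨ *-monoʳ-≤ (N ^ t) second ⟩
    N ^ t * (N ^ t * bicliques t)           ≡⟨ *-assoc (N ^ t) _ _ ⟨
    N ^ t * N ^ t * bicliques t             ≡⟨ cong (λ m → m * m * bicliques t) (^-*-assoc n t t) ⟩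
    n ^ (t * t) * n ^ (t * t) * bicliques t ∎
    where
    open ≤-Reasoning
    N = n ^ t
    P = ∑ (tuples n t) codegree
    first : degreeSum ^ t * n ≤ N * P
    first = subst (λ m → degreeSum ^ t * m ≤ m ^ t * P) (length-allFin n)
      (subst (λ s → degreeSum ^ t * length V ≤ length V ^ t * s) (≡.sym (∑-codegree t))
        (power-mean t (λ w → ∑ V (λ v → χ (adj G v w))) V))
    second : P ^ t * N ≤ N ^ t * bicliques t
    second = subst (λ m → P ^ t * m ≤ m ^ t * bicliques t) (length-tuples n t)
      (subst (λ s → P ^ t * length (tuples n t) ≤ length (tuples n t) ^ t * s)
        (∑-cong (λ S → ≡.sym (∑-tuples-all t (common S))) (tuples n t))
        (power-mean t codegree (tuples n t)))

  -- Defective pairs and the choice of a rich biclique.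

  module _ (r h : ℕ) where

    -- Counts the witnesses against `Rich T T′`. Asking that all of `S ++ T′`, and not only `S`, be
    -- joined to `T` makes `T` a tuple drawn from the common neighbourhood of `S ++ T′`, and makes
    -- the count vanish on pairs that are not joined.
    defective : List (Fin n) → List (Fin n) → ℕ
    defective T T′ = ∑ (tuples n r) λ S →
      χ (complete (S ++ T′) T ∧ (codegree (S ++ T′) <ᵇ h))

    -- Exchange the sums so that `T` is chosen last: there are n^t choices of `T′`, n^r of `S`, and
    -- then at most (h-1)^t of `T`.
    defective-upper-bound : ∀ t →
      ∑ (tuples n t) (λ T → ∑ (tuples n t) (λ T′ → defective T T′)) ≤ n ^ t * (n ^ r * (h ∸ 1) ^ t)
    defective-upper-bound t = begin
      ∑ Vᵗ (λ T → ∑ Vᵗ (λ T′ → defective T T′))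
        ≡⟨ ∑-swap defective Vᵗ Vᵗ ⟩
      ∑ Vᵗ (λ T′ → ∑ Vᵗ (λ T → defective T T′))
        ≤⟨ ∑-bound (λ T′ → begin
          ∑ Vᵗ (λ T → defective T T′)
            ≡⟨ ∑-swap (λ T S → χ (complete (S ++ T′) T ∧ (codegree (S ++ T′) <ᵇ h))) Vᵗ (tuples n r) ⟩
          ∑ (tuples n r) (λ S → ∑ Vᵗ (λ T → χ (complete (S ++ T′) T ∧ (codegree (S ++ T′) <ᵇ h))))
            ≤⟨ ∑-bound (λ S → few (S ++ T′)) (tuples n r) ⟩
          length (tuples n r) * (h ∸ 1) ^ t
            ≡⟨ cong (_* (h ∸ 1) ^ t) (length-tuples n r) ⟩
          n ^ r * (h ∸ 1) ^ t ∎) Vᵗ ⟩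
      length Vᵗ * (n ^ r * (h ∸ 1) ^ t)
        ≡⟨ cong (_* (n ^ r * (h ∸ 1) ^ t)) (length-tuples n t) ⟩
      n ^ t * (n ^ r * (h ∸ 1) ^ t) ∎
      where
      open ≤-Reasoning
      Vᵗ = tuples n t
      -- For fixed `Q` the test on `codegree Q` does not depend on `T`; when it succeeds, `T` has
      -- its entries in a set of at most `h ∸ 1` vertices.
      few : ∀ Q → ∑ Vᵗ (λ T → χ (complete Q T ∧ (codegree Q <ᵇ h))) ≤ (h ∸ 1) ^ t
      few Q with codegree Q <ᵇ h in eq
      ... | false = ≤-trans (≤-reflexive (≡.trans (∑-cong (λ T → cong χ (∧-zeroʳ (complete Q T))) Vᵗ) (∑-zero Vᵗ))) z≤n
      ... | true  = begin
        ∑ Vᵗ (λ T → χ (complete Q T ∧ true)) ≡⟨ ∑-cong (λ T → cong χ (∧-identityʳ (complete Q T))) Vᵗ ⟩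
        ∑ Vᵗ (λ T → χ (complete Q T))        ≡⟨ ∑-tuples-all t (common Q) ⟩
        codegree Q ^ t                       ≤⟨ ^-monoˡ-≤ t (<⇒≤pred (<ᵇ⇒< (codegree Q) h (Equivalence.from T-≡ eq))) ⟩
        (h ∸ 1) ^ t                          ∎
    -- `codegree (S ++ T′)` is the size of N(S) ∩ N(T′): tuples taken on the side N(T) keep `h`
    -- common neighbours inside N(T′).
    Rich : List (Fin n) → List (Fin n) → Set
    Rich T T′ = ∀ S → length S ≡ r → complete S T ≡ true → h ≤ codegree (S ++ T′)

    -- A violating `S` would contribute 1 to `defective T T′`; the hypothesis that `T′` and `T` are
    -- joined supplies the `T′` half of the test in that summand.
    defective≡0⇒Rich : ∀ T T′ → complete T′ T ≡ true → defective T T′ ≡ 0 → Rich T T′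
    defective≡0⇒Rich T T′ T′T none S |S|≡r ST = ≮⇒≥ λ small → contradiction
      (χ≡0⇒false _ (n≤0⇒n≡0 (≤-trans (∈⇒≤∑ _ S∈) (≤-reflexive none))))
      (not-¬ (∧-true⁺ (≡.trans (complete-++ S T′ T) (∧-true⁺ ST T′T)) (Equivalence.to T-≡ (<⇒<ᵇ small))))
      where
      S∈ : S ∈ tuples n r
      S∈ = subst (λ k → S ∈ tuples n k) |S|≡r (∈-tuples⁺ S)

    -- Both orders of the pair have the same total defect, whence the factor 2. Averaging gives a
    -- pair whose combined defect lies strictly below its indicator of being joined, so the
    -- indicator is 1 and both defects are 0.
    ∃-rich-biclique : ∀ t → 2 * (n ^ t * (n ^ r * (h ∸ 1) ^ t)) < bicliques t →
      ∃₂ λ T T′ → length T ≡ t × length T′ ≡ t × complete T T′ ≡ true × Rich T T′ × Rich T′ T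
    ∃-rich-biclique t many
      with ∑-<⇒∃ (λ T → ∑ Vᵗ (λ T′ → defective T T′ + defective T′ T)) (λ T → ∑ Vᵗ (λ T′ → χ (complete T T′)))
             Vᵗ (≤-<-trans bound many)
      where
      open ≤-Reasoning
      Vᵗ = tuples n t
      D = ∑ Vᵗ (λ T → ∑ Vᵗ (λ T′ → defective T T′))
      bound : ∑ Vᵗ (λ T → ∑ Vᵗ (λ T′ → defective T T′ + defective T′ T)) ≤ 2 * (n ^ t * (n ^ r * (h ∸ 1) ^ t))
      bound = begin
        ∑ Vᵗ (λ T → ∑ Vᵗ (λ T′ → defective T T′ + defective T′ T))
          ≡⟨ ∑-cong (λ T → ∑-distrib-+ (λ T′ → defective T T′) (λ T′ → defective T′ T) Vᵗ) Vᵗ ⟩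
        ∑ Vᵗ (λ T → ∑ Vᵗ (λ T′ → defective T T′) + ∑ Vᵗ (λ T′ → defective T′ T))
          ≡⟨ ∑-distrib-+ (λ T → ∑ Vᵗ (λ T′ → defective T T′)) (λ T → ∑ Vᵗ (λ T′ → defective T′ T)) Vᵗ ⟩
        D + ∑ Vᵗ (λ T → ∑ Vᵗ (λ T′ → defective T′ T))
          ≡⟨ cong (D +_) (∑-swap (λ T T′ → defective T′ T) Vᵗ Vᵗ) ⟩
        D + D
          ≡⟨ cong (D +_) (+-identityʳ D) ⟨
        2 * D
          ≤⟨ *-monoʳ-≤ 2 (defective-upper-bound t) ⟩
        2 * (n ^ t * (n ^ r * (h ∸ 1) ^ t)) ∎
    ... | T , T∈ , lt with ∑-<⇒∃ (λ T′ → defective T T′ + defective T′ T) (λ T′ → χ (complete T T′)) (tuples n t) lt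
    ...   | T′ , T′∈ , lt′ =
      T , T′ , ∈-tuples⁻ t T∈ , ∈-tuples⁻ t T′∈ , TT′ ,
      defective≡0⇒Rich T T′ (≡.trans (complete-comm T′ T) TT′) (m+n≡0⇒m≡0 _ none) ,
      defective≡0⇒Rich T′ T TT′ (m+n≡0⇒n≡0 (defective T T′) none)
      where
      TT′ : complete T T′ ≡ true
      TT′ = χ>0⇒true _ (≤-<-trans z≤n lt′)
      none : defective T T′ + defective T′ T ≡ 0
      none = n<1⇒n≡0 (<-≤-trans lt′ (χ-≤1 (complete T T′)))

-- Greedy embedding along a degeneracy order.

length-filter-≟ : ∀ (p : A → Bool) xs → length (filter (λ x → p x Bool.≟ true) xs) ≡ ∑ xs (χ ∘ p)
length-filter-≟ p []       = refl
length-filter-≟ p (x ∷ xs) with p x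
... | true  = cong suc (length-filter-≟ p xs)
... | false = length-filter-≟ p xs

all-replicate : ∀ (p : A → Bool) {x} k → p x ≡ true → all p (replicate k x) ≡ true
all-replicate p zero    px = refl
all-replicate p (suc k) px = ∧-true⁺ px (all-replicate p k px)

remove : ∀ {h} → Fin h → (Fin h → Bool) → Fin h → Bool
remove v S u = S u ∧ not (does (u Fin.≟ v))

remove-self : ∀ {h} (v : Fin h) S → remove v S v ≡ false
remove-self v S with v Fin.≟ v
... | yes _  = ∧-zeroʳ (S v)
... | no v≢v = ⊥-elim (v≢v refl)

remove-≢ : ∀ {h} {v u : Fin h} S → u ≢ v → S u ≡ true → remove v S u ≡ true
remove-≢ {v = v} {u} S u≢v Su with u Fin.≟ v
... | yes u≡v = ⊥-elim (u≢v u≡v)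
... | no _    = ∧-true⁺ Su refl

χ-remove-≤ : ∀ {h} (v : Fin h) S u → χ (remove v S u) ≤ χ (S u)
χ-remove-≤ v S u = ≤-trans (≤-reflexive (cong χ (∧-comm (S u) _))) (χ-∧-≤ _ (S u))

-- Fewer than h vertices are in use, so h candidates always include a fresh one.
fresh : ∀ {h n} (v : Fin h) S (f : Fin h → Fin n) (good : Fin n → Bool) → h ≤ ∑ (allFin n) (χ ∘ good) →
  ∃ λ w → good w ≡ true × (∀ u → remove v S u ≡ true → f u ≢ w)
fresh {h} {n} v S f good many
  with ∑-<⇒∃ used (χ ∘ good) (allFin n) (<-≤-trans few many)
  where
  S′ = remove v S
  used : Fin n → ℕ
  used w = ∑ (allFin h) (λ u → χ (S′ u ∧ does (f u Fin.≟ w)))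
  once : ∀ u → ∑ (allFin n) (λ w → χ (S′ u ∧ does (f u Fin.≟ w))) ≤ χ (S′ u)
  once u with S′ u
  ... | true  = ∑-χ-≟ (f u)
  ... | false = ≤-reflexive (∑-zero (allFin n))
  open ≤-Reasoning
  few : ∑ (allFin n) used < h
  few = begin-strict
    ∑ (allFin n) used
      ≡⟨ ∑-swap (λ w u → χ (S′ u ∧ does (f u Fin.≟ w))) (allFin n) (allFin h) ⟩
    ∑ (allFin h) (λ u → ∑ (allFin n) (λ w → χ (S′ u ∧ does (f u Fin.≟ w))))
      ≤⟨ ∑-mono-≤ once (allFin h) ⟩
    ∑ (allFin h) (χ ∘ S′)
      <⟨ ∑-mono-< (χ-≤1 ∘ S′) (∈-allFin v) (≤-reflexive (cong (suc ∘ χ) (remove-self v S))) ⟩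
    ∑ (allFin h) (const 1)
      ≡⟨ ≡.trans (length-as-∑ (allFin h)) (length-allFin h) ⟩
    h ∎
... | w , _ , lt = w , χ>0⇒true _ (≤-<-trans z≤n lt) , λ u S′u fu≡w →
  n≮0 (<-≤-trans (≤-trans (hit u S′u fu≡w)
    (∈⇒≤∑ (λ u → χ (remove v S u ∧ does (f u Fin.≟ w))) (∈-allFin u)))
    (≤-reflexive (n<1⇒n≡0 (<-≤-trans lt (χ-≤1 (good w))))))
  where
  hit : ∀ u → remove v S u ≡ true → f u ≡ w → 1 ≤ χ (remove v S u ∧ does (f u Fin.≟ w))
  hit u S′u fu≡w rewrite S′u with f u Fin.≟ w
  ... | yes _    = ≤-refl
  ... | no fu≢w = ⊥-elim (fu≢w fu≡w)

-- Vertices of colour `b` are placed in N(T b). The vertex `a b` lies in N(T b) and serves as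
-- padding and as a default value.
module GreedyEmbedding
  {r h n : ℕ} (H : Graph h) (G : Graph n)
  (c : Fin h → Bool) (proper : ∀ u v → adj H u v ≡ true → c u ≢ c v) (degenerate : Degenerate r H)
  (T : Bool → List (Fin n)) (a : Bool → Fin n) (a-side : ∀ b → common G (T b) (a b) ≡ true)
  (rich : ∀ b → Rich G r h (T (not b)) (T b))
  where

  -- The map is total, but constrained only on `S`. The field `side` is the invariant that keeps
  -- `rich` applicable.
  record PartialEmbedding (S : Fin h → Bool) : Set where
    field
      f    : Fin h → Fin n
      inj  : ∀ u v → S u ≡ true → S v ≡ true → f u ≡ f v → u ≡ v
      hom  : ∀ u v → S u ≡ true → S v ≡ true → adj H u v ≡ true → adj G (f u) (f v) ≡ true
      side : ∀ v → S v ≡ true → common G (T (c v)) (f v) ≡ true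

  extend : ∀ S v → S v ≡ true → degIn H S v ≤ r → PartialEmbedding (remove v S) → PartialEmbedding S
  extend S v Sv deg≤r E = record { f = f′ ; inj = inj′ ; hom = hom′ ; side = side′ }
    where
    open PartialEmbedding E
    isNbr : Fin h → Bool
    isNbr u = S u ∧ adj H v u
    nbrs : List (Fin h)
    nbrs = filter (λ u → isNbr u Bool.≟ true) (allFin h)
    |nbrs|≤r : length nbrs ≤ r
    |nbrs|≤r = ≤-trans (≤-reflexive (length-filter-≟ isNbr (allFin h))) deg≤r
    isNbr⇒≢ : ∀ {u} → adj H v u ≡ true → u ≢ v
    isNbr⇒≢ vu refl with () ← ≡.trans (≡.sym (irrefl H v)) vu
    pad : List (Fin n)
    -- Richness concerns tuples of length exactly `r`; this padding stays in N(T (not (c v))).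
    pad = replicate (r ∸ length nbrs) (a (not (c v)))
    Q : List (Fin n)
    Q = map f nbrs ++ pad
    |Q|≡r : length Q ≡ r
    |Q|≡r = ≡.trans (length-++ (map f nbrs))
      (≡.trans (cong₂ _+_ (length-map f nbrs) (length-replicate (r ∸ length nbrs))) (m+[n∸m]≡n |nbrs|≤r))
    -- A neighbour of `v` has the opposite colour, so the invariant `side` puts its image on the
    -- opposite side.
    nbr-side : ∀ {w} → w ∈ map f nbrs → common G (T (not (c v))) w ≡ true
    nbr-side w∈ with ∈-map⁻ f w∈
    ... | u , u∈ , refl with ∈-filter⁻ (λ u → isNbr u Bool.≟ true) {xs = allFin h} u∈
    ...   | _ , eq with ∧-true⁻ (S u) _ eq
    ...     | Su , vu = subst (λ b → common G (T b) (f u) ≡ true)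
      (¬-not (λ cu≡cv → proper v u vu (≡.sym cu≡cv))) (side u (remove-≢ S (isNbr⇒≢ vu) Su))
    Q-side : complete G Q (T (not (c v))) ≡ true
    Q-side = ≡.trans (complete-comm G Q (T (not (c v))))
      (≡.trans (all-++ (common G (T (not (c v)))) (map f nbrs) pad)
        (∧-true⁺ (∈⇒all _ (map f nbrs) nbr-side) (all-replicate _ (r ∸ length nbrs) (a-side (not (c v))))))
    chosen : ∃ λ w → common G (Q ++ T (c v)) w ≡ true × (∀ u → remove v S u ≡ true → f u ≢ w)
    chosen = fresh v S f (common G (Q ++ T (c v))) (rich (c v) Q |Q|≡r Q-side)
    w : Fin n
    w = proj₁ chosen
    w-new : ∀ u → remove v S u ≡ true → f u ≢ w
    w-new = proj₂ (proj₂ chosen)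
    w-common : common G Q w ≡ true × common G (T (c v)) w ≡ true
    w-common = ∧-true⁻ _ _ (≡.trans (≡.sym (all-++ (λ s → adj G s w) Q (T (c v)))) (proj₁ (proj₂ chosen)))
    w-adj : ∀ u → S u ≡ true → adj H v u ≡ true → adj G (f u) w ≡ true
    w-adj u Su vu = all⇒∈ (proj₁ w-common)
      (∈-++⁺ˡ (∈-map⁺ f (∈-filter⁺ (λ u → isNbr u Bool.≟ true) (∈-allFin u) (∧-true⁺ Su vu))))
    f′ : Fin h → Fin n
    f′ u with u Fin.≟ v
    ... | yes _ = w
    ... | no  _ = f u
    inj′ : ∀ x y → S x ≡ true → S y ≡ true → f′ x ≡ f′ y → x ≡ y
    inj′ x y Sx Sy eq with x Fin.≟ v | y Fin.≟ v
    ... | yes refl | yes refl = refl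
    ... | yes refl | no y≢v   = ⊥-elim (w-new y (remove-≢ S y≢v Sy) (≡.sym eq))
    ... | no x≢v   | yes refl = ⊥-elim (w-new x (remove-≢ S x≢v Sx) eq)
    ... | no x≢v   | no y≢v   = inj x y (remove-≢ S x≢v Sx) (remove-≢ S y≢v Sy) eq
    hom′ : ∀ x y → S x ≡ true → S y ≡ true → adj H x y ≡ true → adj G (f′ x) (f′ y) ≡ true
    hom′ x y Sx Sy xy with x Fin.≟ v | y Fin.≟ v
    ... | yes refl | yes refl = ⊥-elim (isNbr⇒≢ xy refl)
    ... | yes refl | no y≢v   = ≡.trans (Graph.sym G w (f y)) (w-adj y Sy xy)
    ... | no x≢v   | yes refl = w-adj x Sx (≡.trans (Graph.sym H v x) xy)
    ... | no x≢v   | no y≢v   = hom x y (remove-≢ S x≢v Sx) (remove-≢ S y≢v Sy) xy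
    side′ : ∀ x → S x ≡ true → common G (T (c x)) (f′ x) ≡ true
    side′ x Sx with x Fin.≟ v
    ... | yes refl = proj₂ w-common
    ... | no x≢v   = side x (remove-≢ S x≢v Sx)

  -- The vertex of low degree in `S` is removed first and embedded last, when at most `r` of its
  -- neighbours have been placed. The bound `m` drives the recursion.
  embed : ∀ m S → count S < m → PartialEmbedding S
  embed (suc m) S (s≤s |S|≤m) with any? (λ v → S v Bool.≟ true)
  ... | no empty = record
    -- An arbitrary total map: on the empty set every condition is vacuous.
    { f    = a ∘ c
    ; inj  = λ u _ Su → ⊥-elim (empty (u , Su))
    ; hom  = λ u _ Su → ⊥-elim (empty (u , Su))
    ; side = λ u Su → ⊥-elim (empty (u , Su))
    }
  ... | yes nonempty with degenerate S nonempty
  ...   | v , Sv , deg≤r = extend S v Sv deg≤r (embed m (remove v S) (<-≤-trans fewer |S|≤m))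
    where
    fewer : count (remove v S) < count S
    fewer = ∑-mono-< (χ-remove-≤ v S) (∈-allFin v)
      (≤-reflexive (≡.trans (cong (suc ∘ χ) (remove-self v S)) (cong χ (≡.sym Sv))))

  embedding : H ⊆G G
  embedding = f , (λ {u} {v} → inj u v refl refl) , λ u v → hom u v refl refl
    where open PartialEmbedding (embed (suc (count {h} (const true))) (const true) ≤-refl)

rich-biclique⇒⊆G : ∀ {r h n} (H : Graph h) (G : Graph n) → Bipartite H → Degenerate r H →
  ∀ T T′ → 0 < length T → 0 < length T′ → complete G T T′ ≡ true →
  Rich G r h T T′ → Rich G r h T′ T → H ⊆G G
rich-biclique⇒⊆G {n = n} H G (c , proper) degenerate T@(x ∷ _) T′@(y ∷ _) _ _ TT′ TrT′ T′rT =
  GreedyEmbedding.embedding H G c proper degenerate side rep rep-side rich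
  where
  side : Bool → List (Fin n)
  side true  = T
  side false = T′
  rep : Bool → Fin n
  -- An entry of `T′` is a common neighbour of `T`, and conversely.
  rep true  = y
  rep false = x
  rep-side : ∀ b → common G (side b) (rep b) ≡ true
  rep-side true  = all⇒∈ {p = common G T} {T′} TT′ (here refl)
  rep-side false = all⇒∈ {p = common G T′} {T} (≡.trans (complete-comm G T′ T) TT′) (here refl)
  rich : ∀ b → Rich G _ _ (side (not b)) (side b)
  rich true  = T′rT
  rich false = TrT′

-- Arithmetic comparison of the two counts.

4[h-1]⁴<n : ∀ h n → h ^ 10 < n → 4 * (h ∸ 1) ^ 4 < n
4[h-1]⁴<n zero    n h¹⁰<n = h¹⁰<n
4[h-1]⁴<n (suc k) n h¹⁰<n = ≤-<-trans (begin
  4 * k ^ 4                                  ≡⟨ split k ⟩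
  -- The constant 4 is absorbed by using 2k ≤ (k+1)^2 twice.
  2 * k * (2 * k) * (k * k)                  ≤⟨ *-mono-≤ (*-mono-≤ 2k≤ 2k≤) (*-mono-≤ (n≤1+n k) (n≤1+n k)) ⟩
  suc k ^ 2 * suc k ^ 2 * (suc k * suc k)    ≡⟨ combine (suc k) ⟩
  suc k ^ 6                                  ≤⟨ ^-monoʳ-≤ (suc k) (m≤m+n 6 4) ⟩
  suc k ^ 10                                 ∎) h¹⁰<n
  where
  open ≤-Reasoning
  split : ∀ k → 4 * (k * (k * (k * (k * 1)))) ≡ 2 * k * (2 * k) * (k * k)
  split = solve-∀
  combine : ∀ s → (s * (s * 1)) * (s * (s * 1)) * (s * s) ≡ s * (s * (s * (s * (s * (s * 1)))))
  combine = solve-∀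
  square : ∀ k → 2 * k + (k * k + 1) ≡ suc k * (suc k * 1)
  square = solve-∀
  2k≤ : 2 * k ≤ suc k ^ 2
  2k≤ = ≤-trans (m≤m+n (2 * k) (k * k + 1)) (≤-reflexive (square k))

-- By `dense`, W is at least n^(2-1/(8r)), so the last hypothesis makes M at least n^(7r/2), against
-- 2 n^(3r) (h-1)^(2r). Squaring removes the half-integral exponent and leaves 4 (h-1)^(4r) < n^r,
-- which is `4k²<a`.
counting : ∀ r h n W M → 1 ≤ r → h ^ 10 < n → n ^ (16 * r ∸ 1) ≤ W ^ (8 * r) →
  let t = 2 * r in
  W ^ (t * t) * n ^ t * n ^ t ≤ n ^ (t * t) * n ^ (t * t) * M →
  2 * (n ^ t * (n ^ r * (h ∸ 1) ^ t)) < M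
counting r@(suc _) h n@(suc _) W M _ h¹⁰<n dense lower = ≰⇒> λ M≤β → <-irrefl refl (begin-strict
  p ^ 4 * (c * c * (c * c))           ≤⟨ *-monoˡ-≤ (c * c * (c * c)) p⁴≤w²a ⟩
  w ^ 2 * a * (c * c * (c * c))       ≡⟨ regroup₁ w a c ⟩
  (w * c * c) ^ 2 * a                 ≤⟨ *-monoˡ-≤ a (^-monoˡ-≤ 2 (≤-trans lower (*-monoʳ-≤ (p * p) M≤β))) ⟩
  (p * p * (2 * (c * (a * k)))) ^ 2 * a ≡⟨ regroup₂ a c k p ⟩
  p ^ 4 * (c * c * (a * a * a)) * (4 * k ^ 2) <⟨ *-monoʳ-< (p ^ 4 * (c * c * (a * a * a))) {{nonZero}} 4k²<a ⟩
  p ^ 4 * (c * c * (a * a * a)) * a   ≡⟨ regroup₃ (p ^ 4) (c * c) a ⟩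
  p ^ 4 * (c * c * (a * a * (a * a))) ≡⟨ cong (λ x → p ^ 4 * (c * c * (x * x))) c≡a² ⟨
  p ^ 4 * (c * c * (c * c))           ∎)
  where
  open ≤-Reasoning
  t = 2 * r
  a = n ^ r
  c = n ^ t
  p = n ^ (t * t)
  w = W ^ (t * t)
  k = (h ∸ 1) ^ t
  instance
    a≢0 : NonZero a
    a≢0 = m^n≢0 n r
    c≢0 : NonZero c
    c≢0 = m^n≢0 n t
    p≢0 : NonZero (p ^ 4)
    p≢0 = m^n≢0 p 4 {{m^n≢0 n (t * t)}}
  nonZero : NonZero (p ^ 4 * (c * c * (a * a * a)))
  nonZero = m*n≢0 (p ^ 4) _ {{p≢0}} {{m*n≢0 (c * c) _ {{m*n≢0 c c}} {{m*n≢0 (a * a) a {{m*n≢0 a a}}}}}}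
  c≡a² : c ≡ a * a
  c≡a² = ≡.trans (^-distribˡ-+-* n r (r + 0)) (cong (λ e → a * n ^ e) (+-identityʳ r))
  -- This is `dense` raised to the power `r`: with t = 2r, (16r-1)r + r = 4t² and 8r·r = 2t².
  p⁴≤w²a : p ^ 4 ≤ w ^ 2 * a
  p⁴≤w²a = begin
    p ^ 4                          ≡⟨ ^-*-assoc n (t * t) 4 ⟩
    n ^ (t * t * 4)                ≡⟨ cong (n ^_) 4t²≡ ⟩
    n ^ ((16 * r ∸ 1) * r + r)     ≡⟨ ^-distribˡ-+-* n ((16 * r ∸ 1) * r) r ⟩
    n ^ ((16 * r ∸ 1) * r) * a     ≡⟨ cong (_* a) (^-*-assoc n (16 * r ∸ 1) r) ⟨
    (n ^ (16 * r ∸ 1)) ^ r * a     ≤⟨ *-monoˡ-≤ a (^-monoˡ-≤ r dense) ⟩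
    (W ^ (8 * r)) ^ r * a          ≡⟨ cong (_* a) (^-*-assoc W (8 * r) r) ⟩
    W ^ (8 * r * r) * a            ≡⟨ cong (λ e → W ^ e * a) (8r²≡2t² r) ⟩
    W ^ (t * t * 2) * a            ≡⟨ cong (_* a) (^-*-assoc W (t * t) 2) ⟨
    w ^ 2 * a                      ∎
    where
    4t²≡16r² : ∀ r → 2 * r * (2 * r) * 4 ≡ 16 * r * r
    4t²≡16r² = solve-∀
    4t²≡ : t * t * 4 ≡ (16 * r ∸ 1) * r + r
    -- As `r` is a successor, `16 * r * r` unfolds to `r + (16 * r ∸ 1) * r`, with no truncation.
    4t²≡ = ≡.trans (4t²≡16r² r) (+-comm r ((16 * r ∸ 1) * r))
    8r²≡2t² : ∀ r → 8 * r * r ≡ 2 * r * (2 * r) * 2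
    8r²≡2t² = solve-∀
  4k²<a : 4 * k ^ 2 < a
  4k²<a = begin-strict
    4 * k ^ 2                    ≡⟨ cong (4 *_) (^-*-assoc (h ∸ 1) t 2) ⟩
    4 * (h ∸ 1) ^ (t * 2)        ≡⟨ cong (λ e → 4 * (h ∸ 1) ^ e) (2t≡4r r) ⟩
    -- Weakening 4 to `4 ^ r` makes the whole expression an r-th power, to be compared with `n ^ r`.
    4 * (h ∸ 1) ^ (4 * r)        ≤⟨ *-monoˡ-≤ ((h ∸ 1) ^ (4 * r)) (^-monoʳ-≤ 4 {1} {r} (s≤s z≤n)) ⟩
    4 ^ r * (h ∸ 1) ^ (4 * r)    ≡⟨ cong (4 ^ r *_) (^-*-assoc (h ∸ 1) 4 r) ⟨
    4 ^ r * ((h ∸ 1) ^ 4) ^ r    ≡⟨ ^-distribʳ-* r 4 ((h ∸ 1) ^ 4) ⟨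
    (4 * (h ∸ 1) ^ 4) ^ r        <⟨ ^-monoˡ-< r (4[h-1]⁴<n h n h¹⁰<n) ⟩
    a                            ∎
    where
    2t≡4r : ∀ r → 2 * r * 2 ≡ 4 * r
    2t≡4r = solve-∀
  regroup₁ : ∀ w a c → w * (w * 1) * a * (c * c * (c * c)) ≡ w * c * c * (w * c * c * 1) * a
  regroup₁ = solve-∀
  regroup₂ : ∀ a c k p →
    p * p * (2 * (c * (a * k))) * (p * p * (2 * (c * (a * k))) * 1) * a
    ≡ p * (p * (p * (p * 1))) * (c * c * (a * a * a)) * (4 * (k * (k * 1)))
  regroup₂ = solve-∀
  regroup₃ : ∀ q d a → q * (d * (a * a * a)) * a ≡ q * (d * (a * a * (a * a)))
  regroup₃ = solve-∀

-- The exponent 2 - 1/(8r) is cleared by raising both sides to the power 8r, and the bound on the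
-- maximum is expressed as a bound for every `G` without a copy of `H`.
theorem7p5 : (r h n : ℕ) → 1 ≤ r → (H : Graph h) → Bipartite H → Degenerate r H →
    h ^ 10 < n → (G : Graph n) → ¬ (H ⊆G G) →
    edges G ^ (8 * r) < n ^ (16 * r ∸ 1)
theorem7p5 r h n 1≤r H bipartite degenerate h¹⁰<n G H⊈G = ≰⇒> λ dense →
  let T , T′ , |T| , |T′| , TT′ , TrT′ , T′rT = ∃-rich-biclique G r h (2 * r)
        (counting r h n (degreeSum G) (bicliques G (2 * r)) 1≤r h¹⁰<n
          (≤-trans dense (^-monoˡ-≤ (8 * r) (edges≤degreeSum G)))
          (bicliques-lower-bound G (2 * r)))
  in H⊈G (rich-biclique⇒⊆G H G bipartite degenerate T T′
       (subst (0 <_) (≡.sym |T|) 0<2r) (subst (0 <_) (≡.sym |T′|) 0<2r) TT′ TrT′ T′rT)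
  where
  0<2r : 0 < 2 * r
  0<2r = ≤-trans 1≤r (m≤m+n r _)
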